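{- For every triangle-free graph $G$, $\varphi(G) \geq \hat{\varphi}(G) \geq \psi(G)-2$.
   Context: All graphs are finite, simple and undirected, with at least one vertex. $\chi$ denotes the chromatic number. For a proper vertex coloring $c$ of $G$ and an induced subgraph $H$ of $G$, let $c(H)$ be the set of colors used by $c$ on the vertices of $H$. Define $\varphi_c(G)=\max_{H}\,(|c(H)|-\chi(H))$ over all induced subgraphs $H$ of $G$, and $\hat{\varphi}_c(G)$ as the same maximum taken only over all connected induced subgraphs $H$ of $G$. Define $\varphi(G)=\min_c \varphi_c(G)$ and $\hat{\varphi}(G)=\min_c \hat{\varphi}_c(G)$, the minima over all proper colorings $c$ of $G$ (with any number of colors). The local chromatic number $\psi(G)$ is the minimum, over all proper colorings $c$ of $G$, of the maximum over vertices $v$ of the number of colors used by $c$ on the closed neighborhood of $v$. -}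

module Defs where

open import Data.Fin.Base using (Fin; zero; suc; toℕ; fromℕ<)
open import Data.Fin.Properties using (toℕ-injective; toℕ<n; toℕ-fromℕ<; all?; any?)
  renaming (_≟_ to _≟ᶠ_)
open import Data.Fin.Subset using (Subset; inside; outside; _∈_; ⊤; ⁅_⁆; Nonempty)
open import Data.Fin.Subset.Properties
  using (_∈?_; nonempty?; ∈⊤; x∈⁅x⁆; x∈⁅y⁆⇒x≡y)
open import Data.List.Base
  using (List; []; _∷_; length; map; filter; deduplicate; allFin; _++_; cartesianProductWith)
open import Data.List.Extrema.Nat
  using (argmin; argmax; argmin-all; argmax-all; f[argmin]≤f[xs]; f[xs]≤f[argmax])
open import Data.List.Membership.Propositional using () renaming (_∈_ to _∈ˡ_)
open import Data.List.Membership.Propositional.Properties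
  using (∈-allFin; ∈-filter⁺; ∈-map⁺; ∈-++⁺ˡ; ∈-++⁺ʳ; ∈-cartesianProductWith⁺)
open import Data.List.Properties using (filter-≐; length-map)
open import Data.List.Relation.Unary.All using (lookup)
open import Data.List.Relation.Unary.All.Properties using (all-filter)
open import Data.List.Relation.Unary.Any using (here)
open import Data.Nat.Base using (ℕ; zero; suc; _≤_; _<_; _∸_; NonZero; s≤s⁻¹; >-nonZero⁻¹)
open import Data.Nat.Properties using (_≟_; n≤1+n; ≤-antisym; ≤-refl; ≤-trans; m≤n⇒m<n∨m≡n)
open import Data.Product.Base using (∃; _×_; _,_; proj₁; proj₂)
open import Data.Sum.Base using (_⊎_; inj₁; inj₂)
import Data.Vec.Base as Vec
open import Data.Vec.Properties using (lookup∘tabulate)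
open import Data.Unit.Base using () renaming (⊤ to Unit)
open import Function.Base using (_∘_)
open import Function.Bundles using (_⇔_; mk⇔; module Equivalence)
open import Level using (0ℓ)
open import Relation.Binary.Construct.Closure.ReflexiveTransitive using (Star; ε; _◅_; _◅◅_)
open import Relation.Binary.Core using (Rel)
open import Relation.Binary.Definitions using () renaming (Decidable to Decidable₂)
open import Relation.Binary.PropositionalEquality
  using (_≡_; _≢_; refl; sym; trans; cong; subst)
open import Relation.Nullary using (¬_; Dec; yes; no; does; contradiction)
open import Relation.Nullary.Decidable using (¬?; _×-dec_; _⊎-dec_; _→-dec_; map′)
open import Relation.Unary using (Pred; Decidable)

private variable
  A : Set
  m n : ℕ

record IsMinimum (P : Pred A 0ℓ) (f : A → ℕ) (m : ℕ) : Set where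
  field
    attained : ∃ λ a → P a × f a ≡ m
    bound    : ∀ a → P a → m ≤ f a

record IsMaximum (P : Pred A 0ℓ) (f : A → ℕ) (m : ℕ) : Set where
  field
    attained : ∃ λ a → P a × f a ≡ m
    bound    : ∀ a → P a → f a ≤ m

module _ {P : Pred A 0ℓ} (P? : Decidable P) (f : A → ℕ) (xs : List A)
         (cover : ∀ a → P a → ∃ λ x → x ∈ˡ xs × P x × f x ≡ f a) where

  minimum-exists : ∃ P → ∃ (IsMinimum P f)
  minimum-exists (a₀ , pa₀) = f b , record
    { attained = b , argmin-all f pa₀ (all-filter P? xs) , refl
    ; bound    = λ a pa → let x , x∈ , px , eq = cover a pa in
        subst (f b ≤_) eq
          (lookup (f[argmin]≤f[xs] {f = f} a₀ ys) (∈-filter⁺ P? x∈ px))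
    }
    where
    ys : List A
    ys = filter P? xs
    b : A
    b = argmin f a₀ ys

  maximum-exists : ∃ P → ∃ (IsMaximum P f)
  maximum-exists (a₀ , pa₀) = f b , record
    { attained = b , argmax-all f pa₀ (all-filter P? xs) , refl
    ; bound    = λ a pa → let x , x∈ , px , eq = cover a pa in
        subst (_≤ f b) eq
          (lookup (f[xs]≤f[argmax] {f = f} a₀ ys) (∈-filter⁺ P? x∈ px))
    }
    where
    ys : List A
    ys = filter P? xs
    b : A
    b = argmax f a₀ ys

IsMaximum-cong : {P : Pred A 0ℓ} {f g : A → ℕ} → (∀ a → f a ≡ g a) →
                 IsMaximum P f m → IsMaximum P g n → m ≡ n
IsMaximum-cong {m = m} {n = n} {f = f} {g} f≗g M N = ≤-antisym (m≤n _ M.attained) (n≤m _ N.attained)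
  where
  module M = IsMaximum M
  module N = IsMaximum N
  m≤n : ∀ k → (∃ λ a → _ × f a ≡ k) → k ≤ n
  m≤n k (a , pa , refl) = subst (_≤ n) (sym (f≗g a)) (N.bound a pa)
  n≤m : ∀ k → (∃ λ a → _ × g a ≡ k) → k ≤ m
  n≤m k (a , pa , refl) = subst (_≤ m) (f≗g a) (M.bound a pa)

filter-map : ∀ {B : Set} (f : A → B) {P : Pred B 0ℓ} (P? : Decidable P) xs →
             filter P? (map f xs) ≡ map f (filter (P? ∘ f) xs)
filter-map f P? []       = refl
filter-map f P? (x ∷ xs) with P? (f x)
... | yes _ = cong (f x ∷_) (filter-map f P? xs)
... | no  _ = filter-map f P? xs

subsets : ∀ n → List (Subset n)
subsets zero    = Vec.[] ∷ []
subsets (suc n) = map (inside Vec.∷_) (subsets n) ++ map (outside Vec.∷_) (subsets n)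

∈-subsets : (S : Subset n) → S ∈ˡ subsets n
∈-subsets Vec.[]              = here refl
∈-subsets (inside  Vec.∷ S) = ∈-++⁺ˡ (∈-map⁺ (inside Vec.∷_) (∈-subsets S))
∈-subsets (outside Vec.∷ S) = ∈-++⁺ʳ _ (∈-map⁺ (outside Vec.∷_) (∈-subsets S))

vectors : ∀ m n → List (Vec.Vec (Fin m) n)
vectors m zero    = Vec.[] ∷ []
vectors m (suc n) = cartesianProductWith Vec._∷_ (allFin m) (vectors m n)

∈-vectors : (v : Vec.Vec (Fin m) n) → v ∈ˡ vectors m n
∈-vectors Vec.[]       = here refl
∈-vectors (x Vec.∷ v) = ∈-cartesianProductWith⁺ Vec._∷_ (∈-allFin x) (∈-vectors v)

-- Reachability on a finite set is decidable, by the Floyd–Warshall recursion.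
module _ {R : Rel (Fin n) 0ℓ} (R? : Decidable₂ R) where

  private
    -- k bounds the intermediate vertices of the walk.
    Via : (k : ℕ) → .(k ≤ n) → Rel (Fin n) 0ℓ
    Via zero    _   u v = u ≡ v ⊎ R u v
    Via (suc k) k<n u v = Via k (below k<n) u v
                        ⊎ Via k (below k<n) u (fromℕ< k<n) × Via k (below k<n) (fromℕ< k<n) v
      where
      below : k < n → k ≤ n
      below p = ≤-trans (n≤1+n k) p

    via? : ∀ k .(k≤n : k ≤ n) u v → Dec (Via k k≤n u v)
    via? zero    _   u v = (u ≟ᶠ v) ⊎-dec R? u v
    via? (suc k) k<n u v = via? k _ u v ⊎-dec (via? k _ u _ ×-dec via? k _ _ v)

    sound : ∀ k .(k≤n : k ≤ n) {u v} → Via k k≤n u v → Star R u v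
    sound zero    _   (inj₁ refl)      = ε
    sound zero    _   (inj₂ r)         = r ◅ ε
    sound (suc k) k<n (inj₁ p)         = sound k _ p
    sound (suc k) k<n (inj₂ (p , q))   = sound k _ p ◅◅ sound k _ q

    base : ∀ k .(k≤n : k ≤ n) {u v} → u ≡ v ⊎ R u v → Via k k≤n u v
    base zero    _   p = p
    base (suc k) k<n p = inj₁ (base k _ p)

    compose : ∀ k .(k≤n : k ≤ n) {u x v} → toℕ x < k → Via k k≤n u x → Via k k≤n x v → Via k k≤n u v
    compose (suc k) k<n {x = x} x<1+k p q with m≤n⇒m<n∨m≡n (s≤s⁻¹ x<1+k)
    ... | inj₂ x≡k with refl ← toℕ-injective {i = x} {j = fromℕ< k<n} (trans x≡k (sym (toℕ-fromℕ< k<n))) =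
      inj₂ (left p , right q)
      where
      left : Via (suc k) k<n _ (fromℕ< k<n) → Via k _ _ (fromℕ< k<n)
      left (inj₁ r)       = r
      left (inj₂ (r , _)) = r
      right : Via (suc k) k<n (fromℕ< k<n) _ → Via k _ (fromℕ< k<n) _
      right (inj₁ r)       = r
      right (inj₂ (_ , r)) = r
    compose (suc k) k<n _ (inj₁ p)       (inj₁ q)       | inj₁ x<k = inj₁ (compose k _ x<k p q)
    compose (suc k) k<n _ (inj₁ p)       (inj₂ (q , r)) | inj₁ x<k = inj₂ (compose k _ x<k p q , r)
    compose (suc k) k<n _ (inj₂ (p , q)) (inj₁ r)       | inj₁ x<k = inj₂ (p , compose k _ x<k q r)
    compose (suc k) k<n _ (inj₂ (p , _)) (inj₂ (_ , r)) | inj₁ x<k = inj₂ (p , r)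

    complete : ∀ {u v} → Star R u v → Via n ≤-refl u v
    complete ε        = base n _ (inj₁ refl)
    complete (r ◅ rs) = compose n _ (toℕ<n _) (base n _ (inj₂ r)) (complete rs)

  star? : Decidable₂ (Star R)
  star? u v = map′ (sound n _) complete (via? n _ u v)

record Graph : Set₁ where
  field
    order       : ℕ
    {{nonZero}} : NonZero order

  Vertex : Set
  Vertex = Fin order

  field
    Adj    : Rel Vertex 0ℓ
    adj?   : Decidable₂ Adj
    symm   : ∀ {u v} → Adj u v → Adj v u
    irrefl : ∀ {v} → ¬ Adj v v

TriangleFree : Graph → Set
TriangleFree G = ∀ u v w → ¬ (Adj u v × Adj v w × Adj u w)
  where open Graph G

-- An induced subgraph is given by its vertex set, which must be nonempty for it
-- to be a graph; G itself is ⊤.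
module _ (G : Graph) where
  open Graph G

  Coloring : Set
  Coloring = Vertex → ℕ

  -- Proper coloring of the subgraph induced on S; values off S are irrelevant.
  ProperOn : Subset order → Coloring → Set
  ProperOn S c = ∀ u v → u ∈ S → v ∈ S → Adj u v → c u ≢ c v

  Proper : Coloring → Set
  Proper = ProperOn ⊤

  colors : Coloring → Subset order → List ℕ
  colors c S = deduplicate _≟_ (map c (filter (_∈? S) (allFin order)))

  #colors : Coloring → Subset order → ℕ
  #colors c S = length (colors c S)

  AdjIn : Subset order → Rel Vertex 0ℓ
  AdjIn S u v = u ∈ S × v ∈ S × Adj u v

  Connected : Subset order → Set
  Connected S = Nonempty S × (∀ u v → u ∈ S → v ∈ S → Star (AdjIn S) u v)

  N[_] : Vertex → Subset order
  N[ v ] = Vec.tabulate λ u → does ((u ≟ᶠ v) ⊎-dec adj? v u)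

  properOn? : ∀ S → Decidable (ProperOn S)
  properOn? S c = all? λ u → all? λ v →
    (u ∈? S) →-dec ((v ∈? S) →-dec (adj? u v →-dec ¬? (c u ≟ c v)))

  connected? : Decidable Connected
  connected? S = nonempty? S ×-dec all? λ u → all? λ v →
    (u ∈? S) →-dec ((v ∈? S) →-dec
      star? (λ x y → (x ∈? S) ×-dec ((y ∈? S) ×-dec adj? x y)) u v)

  toℕ-proper : ∀ S → ProperOn S toℕ
  toℕ-proper S u v _ _ uv eq with refl ← toℕ-injective {i = u} {j = v} eq = irrefl uv

  someVertex : Vertex
  someVertex = fromℕ< (>-nonZero⁻¹ order)

  singleton-connected : Connected ⁅ someVertex ⁆
  singleton-connected = (someVertex , x∈⁅x⁆ someVertex) , λ u v u∈ v∈ →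
    subst (Star _ u) (trans (x∈⁅y⁆⇒x≡y _ u∈) (sym (x∈⁅y⁆⇒x≡y _ v∈))) ε

  infix 4 _∼_
  _∼_ : Rel Coloring 0ℓ
  c ∼ d = ∀ u v → c u ≡ c v ⇔ d u ≡ d v

  #colors-resp-∼ : ∀ {c d} → c ∼ d → ∀ S → #colors c S ≡ #colors d S
  #colors-resp-∼ {c} {d} c∼d S = go (filter (_∈? S) (allFin order))
    where
    reps : Coloring → List Vertex → List Vertex
    reps e = deduplicate (λ u v → e u ≟ e v)

    dedup-map : ∀ e us → deduplicate _≟_ (map e us) ≡ map e (reps e us)
    dedup-map e []       = refl
    dedup-map e (u ∷ us) = cong (e u ∷_)
      (trans (cong (filter _) (dedup-map e us)) (filter-map e (λ k → ¬? (e u ≟ k)) (reps e us)))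

    reps-≡ : ∀ us → reps c us ≡ reps d us
    reps-≡ []       = refl
    reps-≡ (u ∷ us) = cong (u ∷_) (trans
      (cong (filter _) (reps-≡ us))
      (filter-≐ _ _ ( (λ {v} ¬p → ¬p ∘ Equivalence.from (c∼d u v))
                    , (λ {v} ¬p → ¬p ∘ Equivalence.to (c∼d u v))) (reps d us)))

    go : ∀ us → length (deduplicate _≟_ (map c us)) ≡ length (deduplicate _≟_ (map d us))
    go us = trans (len c us) (trans (cong length (reps-≡ us)) (sym (len d us)))
      where
      len : ∀ e us → length (deduplicate _≟_ (map e us)) ≡ length (reps e us)
      len e us = trans (cong length (dedup-map e us)) (length-map e (reps e us))

  properOn-resp-∼ : ∀ {c d} → c ∼ d → ∀ {S} → ProperOn S c → ProperOn S d
  properOn-resp-∼ c∼d p u v u∈ v∈ uv = p u v u∈ v∈ uv ∘ Equivalence.from (c∼d u v)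

  private
    firstSat : ∀ {n} {P : Pred (Fin n) 0ℓ} → Decidable P → Fin n → Fin n
    firstSat {suc n} P? x with P? zero
    ... | yes _ = zero
    firstSat {suc n} P? zero    | no _ = zero
    firstSat {suc n} P? (suc x) | no _ = suc (firstSat (P? ∘ suc) x)

    firstSat-sat : ∀ {n} {P : Pred (Fin n) 0ℓ} (P? : Decidable P) x → P x → P (firstSat P? x)
    firstSat-sat {suc n} P? x px with P? zero
    ... | yes p = p
    firstSat-sat {suc n} P? zero    px | no _ = px
    firstSat-sat {suc n} P? (suc x) px | no _ = firstSat-sat (P? ∘ suc) x px

    firstSat-cong : ∀ {n} {P Q : Pred (Fin n) 0ℓ} (P? : Decidable P) (Q? : Decidable Q) →
      (∀ z → P z → Q z) → (∀ z → Q z → P z) → ∀ x y → P x → Q y → firstSat P? x ≡ firstSat Q? y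
    firstSat-cong {suc n} P? Q? to from x y px qy with P? zero | Q? zero
    ... | yes _ | yes _ = refl
    ... | yes p | no ¬q = contradiction (to zero p) ¬q
    ... | no ¬p | yes q = contradiction (from zero q) ¬p
    firstSat-cong {suc n} P? Q? to from zero    y       px qy | no ¬p | no ¬q = contradiction px ¬p
    firstSat-cong {suc n} P? Q? to from (suc x) zero    px qy | no ¬p | no ¬q = contradiction qy ¬q
    firstSat-cong {suc n} P? Q? to from (suc x) (suc y) px qy | no ¬p | no ¬q =
      cong suc (firstSat-cong (P? ∘ suc) (Q? ∘ suc) (to ∘ suc) (from ∘ suc) x y px qy)

    first : Coloring → Vertex → Vertex
    first c u = firstSat (λ v → c v ≟ c u) u

  fromVec : Vec.Vec Vertex order → Coloring
  fromVec xs = toℕ ∘ Vec.lookup xs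

  -- Recolor each vertex by the first vertex of its color class: up to ∼ there
  -- are only finitely many colorings.
  canonical : Coloring → Vec.Vec Vertex order
  canonical c = Vec.tabulate (first c)

  ∼-canonical : ∀ c → c ∼ fromVec (canonical c)
  ∼-canonical c u v = mk⇔
    (λ eq → cong toℕ (trans (at u) (trans (first-cong eq) (sym (at v)))))
    (λ eq → trans (sym (first-sat u))
              (trans (cong c (trans (sym (at u)) (trans (toℕ-injective eq) (at v)))) (first-sat v)))
    where
    at : ∀ w → Vec.lookup (canonical c) w ≡ first c w
    at = lookup∘tabulate (first c)
    first-sat : ∀ w → c (first c w) ≡ c w
    first-sat w = firstSat-sat (λ z → c z ≟ c w) w refl
    first-cong : c u ≡ c v → first c u ≡ first c v
    first-cong eq = firstSat-cong (λ z → c z ≟ c u) (λ z → c z ≟ c v)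
      (λ _ p → trans p eq) (λ _ p → trans p (sym eq)) u v refl refl

  coloring-minimum : ∀ S (f : Coloring → ℕ) → (∀ {c d} → c ∼ d → f c ≡ f d) →
                     ∃ (IsMinimum (ProperOn S) f)
  coloring-minimum S f f-resp = minimum-exists (properOn? S) f
    (map fromVec (vectors order order))
    (λ c p → fromVec (canonical c) , ∈-map⁺ fromVec (∈-vectors (canonical c))
           , properOn-resp-∼ (∼-canonical c) p , sym (f-resp (∼-canonical c)))
    (toℕ , toℕ-proper S)

  subset-maximum : {P : Pred (Subset order) 0ℓ} → Decidable P → ∃ P →
                   (f : Subset order → ℕ) → ∃ (IsMaximum P f)
  subset-maximum P? ∃P f =
    maximum-exists P? f (subsets order) (λ S p → S , ∈-subsets S , p , refl) ∃P

  χ-minimum : ∀ S → ∃ (IsMinimum (ProperOn S) (λ c → #colors c S))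
  χ-minimum S = coloring-minimum S (λ c → #colors c S) (λ c∼d → #colors-resp-∼ c∼d S)

  χ : Subset order → ℕ
  χ S = proj₁ (χ-minimum S)

  -- For proper c the truncated subtraction is exact, as c is then a proper
  -- coloring of every induced subgraph and so χ S ≤ #colors c S.
  excess : Coloring → Subset order → ℕ
  excess c S = #colors c S ∸ χ S

  excess-resp-∼ : ∀ {c d} → c ∼ d → ∀ S → excess c S ≡ excess d S
  excess-resp-∼ c∼d S = cong (_∸ χ S) (#colors-resp-∼ c∼d S)

  φ[]-maximum : ∀ c → ∃ (IsMaximum Nonempty (excess c))
  φ[]-maximum c = subset-maximum nonempty? (_ , proj₁ singleton-connected) (excess c)

  φ[_] : Coloring → ℕ
  φ[ c ] = proj₁ (φ[]-maximum c)

  φ̂[]-maximum : ∀ c → ∃ (IsMaximum Connected (excess c))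
  φ̂[]-maximum c = subset-maximum connected? (_ , singleton-connected) (excess c)

  φ̂[_] : Coloring → ℕ
  φ̂[ c ] = proj₁ (φ̂[]-maximum c)

  φ-minimum : ∃ (IsMinimum Proper φ[_])
  φ-minimum = coloring-minimum ⊤ φ[_] λ {c} {d} c∼d →
    IsMaximum-cong (excess-resp-∼ c∼d) (proj₂ (φ[]-maximum c)) (proj₂ (φ[]-maximum d))

  φ : ℕ
  φ = proj₁ φ-minimum

  φ̂-minimum : ∃ (IsMinimum Proper φ̂[_])
  φ̂-minimum = coloring-minimum ⊤ φ̂[_] λ {c} {d} c∼d →
    IsMaximum-cong (excess-resp-∼ c∼d) (proj₂ (φ̂[]-maximum c)) (proj₂ (φ̂[]-maximum d))

  φ̂ : ℕ
  φ̂ = proj₁ φ̂-minimum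

  ψ[]-maximum : ∀ c → ∃ (IsMaximum (λ _ → Unit) (λ v → #colors c N[ v ]))
  ψ[]-maximum c = maximum-exists (λ _ → yes _) _ (allFin order)
    (λ v _ → v , ∈-allFin v , _ , refl) (someVertex , _)

  ψ[_] : Coloring → ℕ
  ψ[ c ] = proj₁ (ψ[]-maximum c)

  ψ-minimum : ∃ (IsMinimum Proper ψ[_])
  ψ-minimum = coloring-minimum ⊤ ψ[_] λ {c} {d} c∼d →
    IsMaximum-cong (λ v → #colors-resp-∼ c∼d N[ v ])
      (proj₂ (ψ[]-maximum c)) (proj₂ (ψ[]-maximum d))

  ψ : ℕ
  ψ = proj₁ ψ-minimum

-- Restricting to connected subgraphs can only lower a maximum, which gives
-- φ ≥ φ̂.  For the second bound, evaluate the excess of a coloring on a closed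
-- neighborhood N[ v ]: it is connected, and in a triangle-free graph it induces
-- a star, so its chromatic number is at most 2.
module Submission where

open import Data.Bool.Base using (true; if_then_else_)
open import Data.Fin.Base using (zero; suc; fromℕ<)
open import Data.Fin.Properties using (injective⇒≤; fromℕ<-injective) renaming (_≟_ to _≟ᶠ_)
open import Data.Fin.Subset using (_∈_)
open import Data.Fin.Subset.Properties using (_∈?_)
open import Data.Integer.Base using (+_; _-_; -_; _⊖_; _≥_; +≤+)
import Data.Integer.Properties as ℤ
open import Data.List.Base using (List; length; lookup; filter; allFin)
open import Data.List.Membership.Propositional.Properties using (∈-lookup)
open import Data.List.Relation.Unary.All as All using (All)
open import Data.List.Relation.Unary.All.Properties using (all-filter; deduplicate⁺; map⁺)
open import Data.List.Relation.Unary.AllPairs using (_∷_)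
open import Data.List.Relation.Unary.Unique.DecPropositional.Properties using (deduplicate-!)
open import Data.List.Relation.Unary.Unique.Propositional using (Unique)
open import Data.Nat.Base using (ℕ; _+_; _≤_; _<_; _∸_; z<s; s<s)
open import Data.Nat.Properties using (_≟_; ≤-trans; +-monoʳ-≤; ∸-monoʳ-≤; m≤n+m∸n; m≤m+n; m+n∸m≡n)
open import Data.Product.Base using (_×_; _,_; proj₂)
open import Data.Sum.Base using (_⊎_; inj₁; inj₂)
open import Data.Vec.Properties using (lookup∘tabulate; []=⇒lookup; lookup⇒[]=)
open import Defs
open import Function.Definitions using (Injective)
open import Level using (0ℓ)
open import Relation.Binary.Construct.Closure.ReflexiveTransitive using (Star; ε; _◅_; _◅◅_)
open import Relation.Binary.PropositionalEquality using (_≡_; refl; cong; sym; trans)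
open import Relation.Nullary using (Dec; yes; no; does; contradiction)
open import Relation.Nullary.Decidable using (_⊎-dec_; dec-true)
open import Relation.Unary using (Pred)

does-true⇒ : {A : Set} (a? : Dec A) → does a? ≡ true → A
does-true⇒ (yes a) _ = a

lookup-injective : {A : Set} {xs : List A} → Unique xs → Injective _≡_ _≡_ (lookup xs)
lookup-injective (_ ∷ _)    {zero}  {zero}  _  = refl
lookup-injective (x∉xs ∷ _) {zero}  {suc j} eq = contradiction eq (All.lookup x∉xs (∈-lookup j))
lookup-injective (x∉xs ∷ _) {suc i} {zero}  eq = contradiction (sym eq) (All.lookup x∉xs (∈-lookup i))
lookup-injective (_ ∷ xs!)  {suc i} {suc j} eq with refl ← lookup-injective xs! {i} {j} eq = refl

-- Pigeonhole: sending a position to its entry injects the positions of `xs` into `Fin k`.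
Unique-<⇒length≤ : ∀ {k xs} → Unique xs → All (_< k) xs → length xs ≤ k
Unique-<⇒length≤ {k} {xs} xs! xs<k =
  injective⇒≤ {f = λ i → fromℕ< (bound i)}
    (λ {i} {j} eq → lookup-injective xs! (fromℕ<-injective _ _ (bound i) (bound j) eq))
  where
  bound : ∀ i → lookup xs i < k
  bound i = All.lookup xs<k (∈-lookup i)

maximum≤ : ∀ {A : Set} {P : Pred A 0ℓ} {f : A → ℕ} {m k} →
           IsMaximum P f m → (∀ a → P a → f a ≤ k) → m ≤ k
maximum≤ M f≤k with a , pa , refl ← IsMaximum.attained M = f≤k a pa

-- A minimizer of `g` is also a candidate for the minimum of `f`, so the pointwise bound is applied
-- there.
minimum-mono : ∀ {A : Set} {P : Pred A 0ℓ} {f g : A → ℕ} {m n} k →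
               IsMinimum P f m → IsMinimum P g n → (∀ a → f a ≤ k + g a) → m ≤ k + n
minimum-mono k M N f≤k+g with a , pa , refl ← IsMinimum.attained N =
  ≤-trans (IsMinimum.bound M a pa) (f≤k+g a)

-- Truncation does no harm, since `m ≤ k + (m ∸ k)` holds even when `m < k`. This recovers a color
-- count from a bound on `excess`.
m∸o≤n⇒m≤k+n : ∀ {m n o k} → o ≤ k → m ∸ o ≤ n → m ≤ k + n
m∸o≤n⇒m≤k+n {m} {k = k} o≤k m∸o≤n =
  ≤-trans (m≤n+m∸n m k) (+-monoʳ-≤ k (≤-trans (∸-monoʳ-≤ m o≤k) m∸o≤n))

-- Passes to integers, where `m - k` may be negative: an edgeless graph has `ψ` equal to 1, so its
-- lower bound is -1.
m≤k+n⇒m-k≤n : ∀ m n k → m ≤ k + n → + n ≥ + m - + k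
m≤k+n⇒m-k≤n m n k m≤k+n = begin
  + m - + k         ≤⟨ ℤ.+-monoˡ-≤ (- + k) (+≤+ m≤k+n) ⟩
  + (k + n) - + k   ≡⟨ ℤ.m-n≡m⊖n (k + n) k ⟩
  (k + n) ⊖ k       ≡⟨ ℤ.⊖-≥ (m≤m+n k n) ⟩
  + (k + n ∸ k)     ≡⟨ cong +_ (m+n∸m≡n k n) ⟩
  + n               ∎
  where open ℤ.≤-Reasoning

module _ (G : Graph) where
  open Graph G

  #colors≤ : ∀ {k c S} → (∀ u → u ∈ S → c u < k) → #colors G c S ≤ k
  #colors≤ {S = S} c<k = Unique-<⇒length≤ (deduplicate-! _≟_ _)
    (deduplicate⁺ _≟_ (map⁺ (All.map (λ {u} → c<k u) (all-filter (_∈? S) (allFin order)))))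

  ∈N[]⁻ : ∀ {u v} → u ∈ N[_] G v → u ≡ v ⊎ Adj v u
  ∈N[]⁻ {u} {v} u∈ = does-true⇒ ((u ≟ᶠ v) ⊎-dec adj? v u)
    (trans (sym (lookup∘tabulate _ u)) ([]=⇒lookup u∈))

  ∈N[]⁺ : ∀ {u v} → u ≡ v ⊎ Adj v u → u ∈ N[_] G v
  ∈N[]⁺ {u} {v} p = lookup⇒[]= u _
    (trans (lookup∘tabulate _ u) (dec-true ((u ≟ᶠ v) ⊎-dec adj? v u) p))

  -- Any two vertices are joined by a walk through the center `v`, at most one step on either side.
  N[]-connected : ∀ v → Connected G (N[_] G v)
  N[]-connected v = (v , v∈) , λ u w u∈ w∈ → toCentre u∈ ◅◅ fromCentre w∈
    where
    v∈ : v ∈ N[_] G v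
    v∈ = ∈N[]⁺ (inj₁ refl)

    toCentre : ∀ {u} → u ∈ N[_] G v → Star (AdjIn G (N[_] G v)) u v
    toCentre u∈ with ∈N[]⁻ u∈
    ... | inj₁ refl = ε
    ... | inj₂ vu   = (u∈ , v∈ , symm vu) ◅ ε

    fromCentre : ∀ {u} → u ∈ N[_] G v → Star (AdjIn G (N[_] G v)) v u
    fromCentre u∈ with ∈N[]⁻ u∈
    ... | inj₁ refl = ε
    ... | inj₂ vu   = (v∈ , u∈ , vu) ◅ ε

  -- Intended for `N[ v ]`, where it separates the center from the leaves; the value 1 elsewhere is
  -- arbitrary.
  starColoring : Vertex → Coloring G
  starColoring v u = if does (u ≟ᶠ v) then 0 else 1

  starColoring<2 : ∀ v u → starColoring v u < 2
  starColoring<2 v u with u ≟ᶠ v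
  ... | yes _ = z<s
  ... | no  _ = s<s z<s

  starColoring-proper : TriangleFree G → ∀ v → ProperOn G (N[_] G v) (starColoring v)
  -- If exactly one endpoint is the center, `eq` equates 0 and 1, so those cases are absent.
  starColoring-proper tf v u w u∈ w∈ uw eq with u ≟ᶠ v | w ≟ᶠ v
  ... | yes refl | yes refl = irrefl uw
  ... | no u≢v   | no w≢v   with ∈N[]⁻ u∈ | ∈N[]⁻ w∈
  ...   | inj₁ u≡v | _        = u≢v u≡v
  ...   | inj₂ _   | inj₁ w≡v = w≢v w≡v
  -- Two adjacent leaves would form a triangle with the center.
  ...   | inj₂ vu  | inj₂ vw  = tf v u w (vu , uw , vw)

  χ≤#colors : ∀ {S c} → ProperOn G S c → χ G S ≤ #colors G c S
  χ≤#colors {S} {c} = IsMinimum.bound (proj₂ (χ-minimum G S)) c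

  χ-N[]≤2 : TriangleFree G → ∀ v → χ G (N[_] G v) ≤ 2
  χ-N[]≤2 tf v = ≤-trans (χ≤#colors (starColoring-proper tf v)) (#colors≤ λ u _ → starColoring<2 v u)

  φ̂[]≤φ[] : ∀ c → φ̂[_] G c ≤ φ[_] G c
  φ̂[]≤φ[] c = maximum≤ (proj₂ (φ̂[]-maximum G c))
    λ S (S≢∅ , _) → IsMaximum.bound (proj₂ (φ[]-maximum G c)) S S≢∅

  φ̂≤φ : φ̂ G ≤ φ G
  φ̂≤φ = minimum-mono 0 (proj₂ (φ̂-minimum G)) (proj₂ (φ-minimum G)) φ̂[]≤φ[]

  excess≤φ̂[] : ∀ c {S} → Connected G S → excess G c S ≤ φ̂[_] G c
  excess≤φ̂[] c {S} = IsMaximum.bound (proj₂ (φ̂[]-maximum G c)) S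

  -- `N[ v ]` is one of the connected sets over which `φ̂[ c ]` is the maximum, and at most 2 is
  -- subtracted from its color count.
  #colors-N[]≤2+φ̂[] : TriangleFree G → ∀ c v → #colors G c (N[_] G v) ≤ 2 + φ̂[_] G c
  #colors-N[]≤2+φ̂[] tf c v = m∸o≤n⇒m≤k+n (χ-N[]≤2 tf v) (excess≤φ̂[] c (N[]-connected v))

  ψ[]≤2+φ̂[] : TriangleFree G → ∀ c → ψ[_] G c ≤ 2 + φ̂[_] G c
  ψ[]≤2+φ̂[] tf c = maximum≤ (proj₂ (ψ[]-maximum G c)) λ v _ → #colors-N[]≤2+φ̂[] tf c v

  -- The comparison holds for each fixed coloring, so a coloring optimal for `φ̂` witnesses the
  -- bound on `ψ`.
  ψ≤2+φ̂ : TriangleFree G → ψ G ≤ 2 + φ̂ G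
  ψ≤2+φ̂ tf = minimum-mono 2 (proj₂ (ψ-minimum G)) (proj₂ (φ̂-minimum G)) (ψ[]≤2+φ̂[] tf)

proposition4p7 : (G : Graph) → TriangleFree G →
    (+ (φ G) ≥ + (φ̂ G)) × (+ (φ̂ G) ≥ + (ψ G) - + 2)
proposition4p7 G tf = +≤+ (φ̂≤φ G) , m≤k+n⇒m-k≤n (ψ G) (φ̂ G) 2 (ψ≤2+φ̂ G tf)
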